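{- Every finite tournament is a subtournament of a finite Type-I regular tournament. That is, for every finite tournament $T$ there exist a finite regular tournament $R$ of Type-I and an injective map $f$ from the vertex set of $T$ to the vertex set of $R$ such that for all vertices $x,y$ of $T$, $x\to y$ in $T$ if and only if $f(x)\to f(y)$ in $R$.
   Context: A tournament is a pair $T=(V,E)$, where $V$ is a finite nonempty set of vertices and $E\subseteq V\times V$ is a relation such that $(v,v)\notin E$ for all $v$, and for any two distinct $u,v\in V$ exactly one of $(u,v)\in E$, $(v,u)\in E$ holds. We write $u\to v$ when $(u,v)\in E$. For a vertex $v$, let $\mathrm{IN}(v)=\{u\in V: u\to v\}$ and $\mathrm{OUT}(v)=\{u\in V: v\to u\}$; each of these sets (possibly empty) is regarded as carrying the edge relation induced from $T$. A tournament is regular if $|\mathrm{IN}(v)|=|\mathrm{OUT}(v)|$ for every vertex $v$. A regular tournament is of Type-I if there exists a vertex $v$ such that the induced subtournament on $\mathrm{IN}(v)$ is isomorphic to the induced subtournament on $\mathrm{OUT}(v)$, i.e. there is a bijection $\mathrm{IN}(v)\to\mathrm{OUT}(v)$ preserving and reflecting $\to$. -}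

module Defs where

open import Data.Empty using (⊥-elim)
open import Data.Fin.Base using (Fin)
open import Data.Fin.Properties using (inj⇒≟)
open import Data.Nat.Base using (ℕ)
open import Data.Product.Base using (∃; _×_; _,_; proj₁)
open import Data.Sum.Base using (_⊎_; inj₁; inj₂)
open import Data.Vec.Base using (Vec; tabulate; count)
open import Function.Bundles using (_↔_; _⇔_; module Inverse)
open import Function.Properties.Inverse using (↔⇒↣)
open import Level using (0ℓ)
open import Relation.Binary.Core using (Rel)
open import Relation.Binary.Definitions using (Irrelevant; Decidable; DecidableEquality)
open import Relation.Binary.PropositionalEquality using (_≡_; _≢_; refl)
open import Relation.Nullary using (¬_; yes; no)
import Relation.Unary as U

-- A finite set is a type in bijection with some Fin n.  The edge set is a
-- subset of V × V, hence a proof-irrelevant relation; without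
-- `irrelevant`, ∃ (IN v) could contain the same vertex several times.
record Tournament : Set₁ where
  infix 4 _⟶_ _⟶?_ _≟_
  field
    V           : Set
    size        : ℕ
    enumeration : V ↔ Fin size
    nonempty    : V
    _⟶_         : Rel V 0ℓ
    irrelevant  : Irrelevant _⟶_
    loopless    : ∀ v → ¬ (v ⟶ v)
    exactlyOne  : ∀ u v → u ≢ v →
                  (u ⟶ v × ¬ (v ⟶ u)) ⊎ (v ⟶ u × ¬ (u ⟶ v))

  _≟_ : DecidableEquality V
  _≟_ = inj⇒≟ (↔⇒↣ enumeration)

  _⟶?_ : Decidable _⟶_
  u ⟶? v with u ≟ v
  ... | yes refl = no (loopless u)
  ... | no u≢v with exactlyOne u v u≢v
  ...   | inj₁ (u⟶v , _)  = yes u⟶v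
  ...   | inj₂ (_ , ¬u⟶v) = no ¬u⟶v

  vertices : Vec V size
  vertices = tabulate (Inverse.from enumeration)

  IN OUT : V → U.Pred V 0ℓ
  IN  v u = u ⟶ v
  OUT v u = v ⟶ u

  IN? : ∀ v → U.Decidable (IN v)
  IN? v u = u ⟶? v

  OUT? : ∀ v → U.Decidable (OUT v)
  OUT? v u = v ⟶? u

  -- `vertices` lists each vertex exactly once, so counting along it gives
  -- the cardinality, whatever the enumeration.
  ∣IN∣ ∣OUT∣ : V → ℕ
  ∣IN∣  v = count (IN? v)  vertices
  ∣OUT∣ v = count (OUT? v) vertices

  Induced : (P : U.Pred V 0ℓ) → Rel (∃ P) 0ℓ
  Induced P x y = proj₁ x ⟶ proj₁ y

Isomorphic : {A B : Set} → Rel A 0ℓ → Rel B 0ℓ → Set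
Isomorphic {A} {B} R S =
  ∃ λ (φ : A ↔ B) → ∀ x y → R x y ⇔ S (Inverse.to φ x) (Inverse.to φ y)

Regular : Tournament → Set
Regular T = ∀ v → ∣IN∣ v ≡ ∣OUT∣ v
  where open Tournament T

TypeI : Tournament → Set
TypeI T = Regular T × ∃ λ v → Isomorphic (Induced (IN v)) (Induced (OUT v))
  where open Tournament T

{-# OPTIONS --safe #-}
-- The host consists of an apex and two copies of T, indexed by Bool.  The false
-- copy is the in-neighbourhood of the apex and the true copy its
-- out-neighbourhood, so both are isomorphic to T.  Between the copies,
-- (false , x) ⟶ (true , y) holds iff y ⟶ x in T.  For each vertex v there is an
-- involution of the vertices that exchanges IN v and OUT v, hence regularity:
-- it exchanges the two copies of every y, except that for v = (b , x) it fixes v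
-- and exchanges the apex with the other copy of x.
module Submission where

open import Defs
open import Algebra.Properties.CommutativeMonoid.Sum using (sum; sum-cong-≗; sum-permute)
open import Data.Bool.Base using (Bool; true; false; not; T; if_then_else_)
open import Data.Bool.Properties using (T-irrelevant; not-involutive)
open import Data.Empty using (⊥; ⊥-elim)
open import Data.Fin.Base as Fin using ()
open import Data.Fin.Properties using (1↔⊤; 2↔Bool; +↔⊎; *↔×)
open import Data.Nat.Base using (ℕ; zero; suc; _+_; _*_)
open import Data.Nat.Properties using (+-0-commutativeMonoid)
open import Data.Product.Base using (Σ; ∃; _×_; _,_; proj₁; proj₂)
open import Data.Product.Function.NonDependent.Propositional using (_×-↔_)
open import Data.Sum.Base using (_⊎_; inj₁; inj₂)
open import Data.Sum.Function.Propositional using (_⊎-↔_)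
open import Data.Unit.Base using (⊤; tt)
open import Data.Vec.Base using (count; tabulate)
open import Function.Base using (_∘_; id)
open import Function.Bundles using (_⇔_; _↔_; mk⇔; mk↔ₛ′; module Inverse)
open import Function.Construct.Composition using (_↔-∘_)
open import Function.Construct.Identity using (⇔-id)
open import Function.Construct.Symmetry using (↔-sym; ⇔-sym)
open import Function.Definitions using (Injective)
open import Relation.Binary.PropositionalEquality using (_≡_; _≢_; refl; sym; cong; module ≡-Reasoning)
open import Relation.Nullary using (¬_; Dec; does; yes; no)
open import Relation.Nullary.Decidable using (False; toWitnessFalse; fromWitnessFalse; does-⇔)
open import Relation.Unary using (Pred; Decidable)
open Tournament using (V)

indicator : ∀ {p} {P : Set p} → Dec P → ℕ
indicator P? = if does P? then 1 else 0

count-tabulate : ∀ {a p} {A : Set a} {P : Pred A p} (P? : Decidable P) {n} f →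
                 count P? (tabulate {n = n} f) ≡
                 sum +-0-commutativeMonoid (indicator ∘ P? ∘ f)
count-tabulate P? {zero}  f = refl
count-tabulate P? {suc n} f with does (P? (f Fin.zero))
... | true  = cong suc (count-tabulate P? (f ∘ Fin.suc))
... | false = count-tabulate P? (f ∘ Fin.suc)

module _ (R : Tournament) where
  open Tournament R using (enumeration; vertices)
  open Inverse enumeration using (from; strictlyInverseʳ)

  -- Both counts are sums of indicators over `Fin size`, and a finite sum in a commutative monoid is
  -- invariant under permuting its indices.
  count-permute : ∀ {p q} {P : Pred (V R) p} {Q : Pred (V R) q}
                  (P? : Decidable P) (Q? : Decidable Q) (σ : V R ↔ V R) →
                  (∀ u → P u ⇔ Q (Inverse.to σ u)) →
                  count P? vertices ≡ count Q? vertices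
  count-permute P? Q? σ P⇔Q∘σ = begin
    count P? vertices
      ≡⟨ count-tabulate P? from ⟩
    sum +-0-commutativeMonoid (indicator ∘ P? ∘ from)
      ≡⟨ sum-cong-≗ +-0-commutativeMonoid pointwise ⟩
    sum +-0-commutativeMonoid (indicator ∘ Q? ∘ from ∘ Inverse.to π)
      ≡⟨ sum-permute +-0-commutativeMonoid (indicator ∘ Q? ∘ from) π ⟨
    sum +-0-commutativeMonoid (indicator ∘ Q? ∘ from)
      ≡⟨ count-tabulate Q? from ⟨
    count Q? vertices ∎
    where
    open ≡-Reasoning
    -- `σ` conjugated by the enumeration, so that it acts on indices.
    π = enumeration ↔-∘ (σ ↔-∘ ↔-sym enumeration)

    pointwise : ∀ i → indicator (P? (from i)) ≡ indicator (Q? (from (Inverse.to π i)))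
    pointwise i rewrite strictlyInverseʳ (Inverse.to σ (from i)) =
      cong (if_then 1 else 0) (does-⇔ (P⇔Q∘σ (from i)) (P? _) (Q? _))

module Doubling (T₀ : Tournament) where
  open Tournament T₀ using (size; enumeration; _⟶_; irrelevant; loopless; exactlyOne; _≟_; _⟶?_)

  Vertex : Set
  Vertex = ⊤ ⊎ (Bool × V T₀)

  pattern apex     = inj₁ tt
  pattern copy b x = inj₂ (b , x)

  -- The last clause uses False in place of ¬_, which is not provably
  -- proof-irrelevant without function extensionality.
  infix 4 _⇒_
  _⇒_ : Vertex → Vertex → Set
  apex         ⇒ apex         = ⊥
  apex         ⇒ copy b _     = T b
  copy b _     ⇒ apex         = T (not b)
  copy false x ⇒ copy false y = x ⟶ y
  copy true  x ⇒ copy true  y = x ⟶ y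
  copy false x ⇒ copy true  y = y ⟶ x
  copy true  x ⇒ copy false y = False (x ⟶? y)

  ⇒-irrelevant : ∀ {u v} (p q : u ⇒ v) → p ≡ q
  ⇒-irrelevant {apex}         {copy _ _}     = T-irrelevant
  ⇒-irrelevant {copy _ _}     {apex}         = T-irrelevant
  ⇒-irrelevant {copy false _} {copy false _} = irrelevant
  ⇒-irrelevant {copy true _}  {copy true _}  = irrelevant
  ⇒-irrelevant {copy false _} {copy true _}  = irrelevant
  ⇒-irrelevant {copy true _}  {copy false _} = T-irrelevant

  ⇒-loopless : ∀ v → ¬ (v ⇒ v)
  ⇒-loopless (copy false x) = loopless x
  ⇒-loopless (copy true x)  = loopless x

  -- Within a copy this is inherited from `T₀`; across copies the two directions are an edge
  -- statement of `T₀` and its negation. Deciding that edge reduces `False` to `⊤` or `⊥`, whence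
  -- `tt` and `id`.
  ⇒-exactlyOne : ∀ u v → u ≢ v → (u ⇒ v × ¬ (v ⇒ u)) ⊎ (v ⇒ u × ¬ (u ⇒ v))
  ⇒-exactlyOne apex           apex           u≢v = ⊥-elim (u≢v refl)
  ⇒-exactlyOne apex           (copy false y) _   = inj₂ (tt , id)
  ⇒-exactlyOne apex           (copy true y)  _   = inj₁ (tt , id)
  ⇒-exactlyOne (copy false x) apex           _   = inj₁ (tt , id)
  ⇒-exactlyOne (copy true x)  apex           _   = inj₂ (tt , id)
  ⇒-exactlyOne (copy false x) (copy false y) u≢v = exactlyOne x y (u≢v ∘ cong (copy false))
  ⇒-exactlyOne (copy true x)  (copy true y)  u≢v = exactlyOne x y (u≢v ∘ cong (copy true))
  ⇒-exactlyOne (copy false x) (copy true y)  _   with y ⟶? x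
  ... | yes y⟶x = inj₁ (y⟶x , id)
  ... | no ¬y⟶x = inj₂ (tt , ¬y⟶x)
  ⇒-exactlyOne (copy true x)  (copy false y) _   with x ⟶? y
  ... | yes x⟶y = inj₂ (x⟶y , id)
  ... | no ¬x⟶y = inj₁ (tt , ¬x⟶y)

  double : Tournament
  double = record
    { V           = Vertex
    ; size        = 1 + 2 * size
    ; enumeration = ↔-sym ((1↔⊤ ⊎-↔ ((2↔Bool ×-↔ ↔-sym enumeration) ↔-∘ *↔×)) ↔-∘ +↔⊎)
    ; nonempty    = apex
    ; _⟶_         = _⇒_
    ; irrelevant  = λ {u} {v} → ⇒-irrelevant {u} {v}
    ; loopless    = ⇒-loopless
    ; exactlyOne  = ⇒-exactlyOne
    }

  -- For each `x` there is a 3-cycle from `copy false x` to `apex` to `copy true x` and back. Hence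
  -- each of its vertices has the other two on opposite sides, and these are the ones to exchange.
  reflect : Vertex → Vertex → Vertex
  reflect apex       apex       = apex
  reflect apex       (copy c y) = copy (not c) y
  reflect (copy b x) apex       = copy (not b) x
  reflect (copy b x) (copy c y) with y ≟ x
  reflect (copy b     x) (copy c     y) | no _  = copy (not c) y
  reflect (copy false x) (copy false y) | yes _ = copy false x
  reflect (copy true  x) (copy true  y) | yes _ = copy true x
  reflect (copy false x) (copy true  y) | yes _ = apex
  reflect (copy true  x) (copy false y) | yes _ = apex

  reflect-involutive : ∀ v u → reflect v (reflect v u) ≡ u
  reflect-involutive apex           apex       = refl
  reflect-involutive apex           (copy c y) = cong (λ b → copy b y) (not-involutive c)
  reflect-involutive (copy b x) apex with x ≟ x
  reflect-involutive (copy b x)     apex | no x≢x = ⊥-elim (x≢x refl)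
  reflect-involutive (copy false x) apex | yes _  = refl
  reflect-involutive (copy true x)  apex | yes _  = refl
  -- When the inner `reflect` returns a copy of `y`, the outer one tests `y ≟ x` again; `eq` carries
  -- the result over.
  reflect-involutive (copy b x) (copy c y) with y ≟ x in eq
  reflect-involutive (copy b x) (copy c y) | no _ rewrite eq =
    cong (λ b → copy b y) (not-involutive c)
  reflect-involutive (copy false x) (copy false y) | yes refl rewrite eq = refl
  reflect-involutive (copy true x)  (copy true y)  | yes refl rewrite eq = refl
  reflect-involutive (copy false x) (copy true y)  | yes refl = refl
  reflect-involutive (copy true x)  (copy false y) | yes refl = refl

  -- Off the diagonal, the negated clause of `_⇒_` is a reversed edge of `T₀`.
  ¬⟶⇔⟵ : ∀ {x y} → x ≢ y → False (x ⟶? y) ⇔ y ⟶ x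
  ¬⟶⇔⟵ {x} {y} x≢y with exactlyOne x y x≢y
  ... | inj₁ (x⟶y , ¬y⟶x) =
    mk⇔ (λ f → ⊥-elim (toWitnessFalse f x⟶y)) (λ y⟶x → ⊥-elim (¬y⟶x y⟶x))
  ... | inj₂ (y⟶x , ¬x⟶y) = mk⇔ (λ _ → y⟶x) (λ _ → fromWitnessFalse ¬x⟶y)

  ¬⟲⇔⊤ : ∀ x → False (x ⟶? x) ⇔ ⊤
  ¬⟲⇔⊤ x = mk⇔ _ (λ _ → fromWitnessFalse (loopless x))

  ⟲⇔⊥ : ∀ x → x ⟶ x ⇔ ⊥
  ⟲⇔⊥ x = mk⇔ (loopless x) ⊥-elim

  -- For `v` in a copy of `x` and `y ≢ x`, one copy of `y` is related to `v` as `y` is to `x`, the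
  -- other in the opposite way, so exchanging them swaps the sides of `v`.
  reflect-reverses : ∀ v u → u ⇒ v ⇔ v ⇒ reflect v u
  reflect-reverses apex           apex           = ⇔-id _
  reflect-reverses apex           (copy false y) = ⇔-id _
  reflect-reverses apex           (copy true y)  = ⇔-id _
  reflect-reverses (copy false x) apex           = ⇔-sym (⟲⇔⊥ x)
  reflect-reverses (copy true x)  apex           = ⇔-sym (¬⟲⇔⊤ x)
  reflect-reverses (copy b x) (copy c y) with y ≟ x
  reflect-reverses (copy false x) (copy false y) | yes refl = ⇔-id _
  reflect-reverses (copy true x)  (copy true y)  | yes refl = ⇔-id _
  reflect-reverses (copy false x) (copy true y)  | yes refl = ¬⟲⇔⊤ x
  reflect-reverses (copy true x)  (copy false y) | yes refl = ⟲⇔⊥ x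
  -- For `u` in the false copy both sides are the same edge by definition; for `u` in the true copy
  -- one side is the negated clause.
  reflect-reverses (copy false x) (copy false y) | no _     = ⇔-id _
  reflect-reverses (copy true x)  (copy true y)  | no y≢x   = ⇔-sym (¬⟶⇔⟵ (y≢x ∘ sym))
  reflect-reverses (copy false x) (copy true y)  | no y≢x   = ¬⟶⇔⟵ y≢x
  reflect-reverses (copy true x)  (copy false y) | no _     = ⇔-id _

  double-regular : Regular double
  double-regular v = count-permute double (IN? v) (OUT? v)
    (mk↔ₛ′ (reflect v) (reflect v) (reflect-involutive v) (reflect-involutive v))
    (reflect-reverses v)
    where open Tournament double using (IN?; OUT?)

  open Tournament double using (IN; OUT; Induced)

  IN-apex≅OUT-apex : Isomorphic (Induced (IN apex)) (Induced (OUT apex))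
  IN-apex≅OUT-apex = mk↔ₛ′ to from to∘from from∘to , preserves
    where
    to : ∃ (IN apex) → ∃ (OUT apex)
    -- Membership in `IN apex` computes to `⊥` at the apex and on the true copy, which leaves this
    -- single clause.
    to (copy false x , _) = copy true x , tt

    from : ∃ (OUT apex) → ∃ (IN apex)
    from (copy true x , _) = copy false x , tt

    to∘from : ∀ y → to (from y) ≡ y
    to∘from (copy true x , _) = refl

    from∘to : ∀ x → from (to x) ≡ x
    from∘to (copy false x , _) = refl

    preserves : ∀ x y → proj₁ x ⇒ proj₁ y ⇔ proj₁ (to x) ⇒ proj₁ (to y)
    preserves (copy false _ , _) (copy false _ , _) = ⇔-id _

lemma4p3 : (T : Tournament) →
    Σ Tournament λ R → TypeI R ×
    (∃ λ (f : V T → V R) → Injective _≡_ _≡_ f ×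
    (∀ x y → Tournament._⟶_ T x y ⇔ Tournament._⟶_ R (f x) (f y)))
lemma4p3 T =
  double , (double-regular , apex , IN-apex≅OUT-apex) ,
  -- The edges inside the false copy are by definition those of `T`.
  copy false , (λ { refl → refl }) , λ _ _ → ⇔-id _
  where open Doubling T
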